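{- Let $k$ be a positive integer. (i) If $\mathrm{PCP}(k+2)$ is decidable, then $\mathrm{GPCP}(k)$ is decidable. (ii) If $\mathrm{PCP}(k+2)$ is decidable on erasement-free instances, then $\mathrm{GPCP}(k)$ is decidable on erasement-free instances.
   Context: An alphabet is a finite set of letters; $\Sigma^\star$ is the set of all words over $\Sigma$, including the empty word $\varepsilon$, and $\Sigma^+ = \Sigma^\star \setminus \{\varepsilon\}$. A morphism $\sigma:\Sigma^\star\to\Delta^\star$ is a map with $\sigma(xy)=\sigma(x)\sigma(y)$ for all $x,y\in\Sigma^\star$; it is finitely encoded by its restriction to $\Sigma$. $\mathrm{PCP}$ (Post Correspondence Problem): given an alphabet $\Sigma$ and two morphisms $\sigma,\tau:\Sigma^\star\to\{0,1\}^\star$ (the instance being $(\Sigma,\sigma,\tau)$), decide whether there exists $w\in\Sigma^+$ such that $\sigma(w)=\tau(w)$. $\mathrm{GPCP}$ (Generalized Post Correspondence Problem): given an alphabet $\Sigma$, two morphisms $\sigma,\tau:\Sigma^\star\to\{0,1\}^\star$ and four words $s,t,s',t'\in\{0,1\}^\star$ (the instance being $(\Sigma,\sigma,\tau,s,t,s',t')$), decide whether there exists $w\in\Sigma^\star$ such that $s\,\sigma(w)\,t=s'\,\tau(w)\,t'$. For an integer $k\ge1$, $\mathrm{PCP}(k)$ and $\mathrm{GPCP}(k)$ are the restrictions to instances with $\Sigma$ of cardinality $k$. An instance of $\mathrm{PCP}$ or of $\mathrm{GPCP}$ is erasement-free if $\sigma(a)\neq\varepsilon$ and $\tau(a)\ne\varepsilon$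 for every letter $a\in\Sigma$. Decidable means algorithmically decidable (computable) under the obvious finite encodings of instances; "decidable on a class of instances" refers to the problem restricted to instances in that class. -}

module Defs where

open import Data.Bool.Base using (Bool; true; false)
open import Data.Fin.Base using (Fin)
open import Data.List.Base using (List; []; _∷_; [_]; _++_; tabulate)
open import Data.Nat.Base using (ℕ)
open import Data.Product.Base using (_×_; ∃; ∃-syntax)
open import Relation.Binary.PropositionalEquality.Core using (_≡_; _≢_)
open import Relation.Nullary.Reflects using (Reflects)
open import Relation.Unary using (Pred; U)
open import Level using (0ℓ)

-- Model of computation: the language I of N. D. Jones, "Computability and
-- Complexity from a Programming Perspective" (1997), i.e. WHILE programs over
-- binary trees with a single atom and a single variable X.  I is
-- Turing-complete.

infixr 5 _∙_

data Tree : Set where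
  nil : Tree
  _∙_ : Tree → Tree → Tree

data Expr : Set where
  X    : Expr
  nil  : Expr
  cons : Expr → Expr → Expr
  hd   : Expr → Expr
  tl   : Expr → Expr

infixr 4 _⨾_

data Program : Set where
  X:=_     : Expr → Program
  _⨾_      : Program → Program → Program
  while_⟳_ : Expr → Program → Program

left right : Tree → Tree
left nil      = nil
left (l ∙ r)  = l
right nil     = nil
right (l ∙ r) = r

eval : Expr → Tree → Tree
eval X          x = x
eval nil        x = nil
eval (cons e f) x = eval e x ∙ eval f x
eval (hd e)     x = left (eval e x)
eval (tl e)     x = right (eval e x)

-- p ⊢ x ⇓ y : started with X = x, the program p halts with X = y.

infix 3 _⊢_⇓_

data _⊢_⇓_ : Program → Tree → Tree → Set where
  assign : ∀ {e x} → X:= e ⊢ x ⇓ eval e x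
  seq    : ∀ {p q x y z} → p ⊢ x ⇓ y → q ⊢ y ⇓ z → p ⨾ q ⊢ x ⇓ z
  stop   : ∀ {e p x} → eval e x ≡ nil → while e ⟳ p ⊢ x ⇓ x
  loop   : ∀ {e p x y z} → eval e x ≢ nil →
           p ⊢ x ⇓ y → while e ⟳ p ⊢ y ⇓ z → while e ⟳ p ⊢ x ⇓ z

-- A problem comes with the finite encoding of its instances.

record Problem : Set₁ where
  field
    Instance : Set
    Yes      : Pred Instance 0ℓ
    code     : Instance → Tree

encodeBool : Bool → Tree
encodeBool false = nil
encodeBool true  = nil ∙ nil

encodeList : {A : Set} → (A → Tree) → List A → Tree
encodeList f []       = nil
encodeList f (x ∷ xs) = f x ∙ encodeList f xs

-- Nothing is required of the program outside (the codes of) the class C.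

DecidableOn : (P : Problem) → Pred (Problem.Instance P) 0ℓ → Set
DecidableOn P C =
  ∃[ p ] ∀ i → C i →
    ∃[ b ] (p ⊢ code i ⇓ encodeBool b) × Reflects (Yes i) b
  where open Problem P

Decidable : Problem → Set
Decidable P = DecidableOn P U

-- The binary alphabet {0,1} is Bool, and an alphabet of cardinality k is Fin k.

Word : Set
Word = List Bool

record Morphism (A B : Set) : Set where
  field
    ⟦_⟧  : List A → List B
    homo : ∀ x y → ⟦ x ++ y ⟧ ≡ ⟦ x ⟧ ++ ⟦ y ⟧

open Morphism public using (⟦_⟧)

NonErasing : {A B : Set} → Morphism A B → Set
NonErasing σ = ∀ a → ⟦ σ ⟧ [ a ] ≢ []

encodeWord : Word → Tree
encodeWord = encodeList encodeBool

-- A morphism is encoded by the list of the images of the letters; the length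
-- of that list is the cardinality of the alphabet.

encodeMorphism : ∀ {k} → Morphism (Fin k) Bool → Tree
encodeMorphism σ = encodeList encodeWord (tabulate λ a → ⟦ σ ⟧ [ a ])

record PCPInstance (k : ℕ) : Set where
  field
    σ τ : Morphism (Fin k) Bool

record GPCPInstance (k : ℕ) : Set where
  field
    σ τ       : Morphism (Fin k) Bool
    s t s′ t′ : Word

PCP : ℕ → Problem
PCP k = record
  { Instance = PCPInstance k
  ; Yes      = λ i → let open PCPInstance i in
                 ∃[ w ] w ≢ [] × ⟦ σ ⟧ w ≡ ⟦ τ ⟧ w
  ; code     = λ i → let open PCPInstance i in
                 encodeMorphism σ ∙ encodeMorphism τ
  }

GPCP : ℕ → Problem
GPCP k = record
  { Instance = GPCPInstance k
  ; Yes      = λ i → let open GPCPInstance i in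
                 ∃[ w ] s ++ ⟦ σ ⟧ w ++ t ≡ s′ ++ ⟦ τ ⟧ w ++ t′
  ; code     = λ i → let open GPCPInstance i in
                 encodeMorphism σ ∙ encodeMorphism τ ∙
                 encodeWord s ∙ encodeWord t ∙ encodeWord s′ ∙ encodeWord t′
  }

ErasementFreePCP : ∀ {k} → Pred (PCPInstance k) 0ℓ
ErasementFreePCP i = NonErasing σ × NonErasing τ
  where open PCPInstance i

ErasementFreeGPCP : ∀ {k} → Pred (GPCPInstance k) 0ℓ
ErasementFreeGPCP i = NonErasing σ × NonErasing τ
  where open GPCPInstance i

{-# OPTIONS --safe #-}
module Submission where

-- Add a start letter and a finish letter to Σ and take the images below, over the
-- bits and the symbols d, ▷, ◁, each symbol being spelt out with three bits:
--
--             σ-image              τ-image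
--   start     ▷ d s₁ … d sₘ        ▷ d s′₁ d … s′ₙ d
--   a         d x₁ … d xₘ          y₁ d … yₙ d            (x = σ a, y = τ a)
--   finish    d t₁ … d tₘ d ◁      t′₁ d … t′ₙ d ◁
--
-- A σ-image never starts with a bit and a τ-image never starts with d, so a
-- solution starts with the start letter; from then on the τ-side has one d in
-- excess, which only the finish letter can absorb, and when it first does,
-- s σ(w) t = s′ τ(w) t′.  A letter erased by both morphisms would be a solution
-- by itself, so it is turned into a copy of the start letter.
-- That a WHILE program computes the new instance follows from closing the
-- computable functions under pairing and foldl.

open import Defs
open import Data.Bool.Base using (Bool; true; false)
open import Data.Fin.Base using (Fin; zero; suc)
open import Data.List.Base
  using (List; []; _∷_; [_]; _++_; foldl; foldr; map; reverse; reverseAcc;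
         drop; concatMap; tabulate)
open import Data.List.Properties
  using (reverse-foldl; reverse-involutive; foldr-++; ++-assoc; ++-identityʳ;
         ++-identityˡ-unique; concatMap-++; map-tabulate; map-is-foldr; tabulate-cong; ∷-injectiveˡ;
         ∷-injectiveʳ)
open import Data.Nat.Base using (ℕ; _+_; _≤_)
open import Data.Nat.Properties using (+-comm)
open import Data.Product.Base
  using (_×_; _,_; ∃-syntax; proj₁; proj₂; uncurry)
open import Function.Base using (_∘_; id; const)
open import Function.Bundles using (_⇔_; mk⇔; Equivalence)
open import Relation.Binary.PropositionalEquality hiding ([_])
open import Relation.Nullary.Negation.Core using (contradiction)
open import Relation.Nullary.Reflects using (Reflects; ofʸ; ofⁿ)
open import Relation.Unary using (Pred)
open import Level using (0ℓ)

-- WHILE-computable functions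

infixr 5 _⊗_

data Type : Set where
  bool : Type
  list : Type → Type
  _⊗_  : Type → Type → Type

El : Type → Set
El bool     = Bool
El (list A) = List (El A)
El (A ⊗ B)  = El A × El B

encode : ∀ A → El A → Tree
encode bool     b       = encodeBool b
encode (list A) xs      = encodeList (encode A) xs
encode (A ⊗ B)  (x , y) = encode A x ∙ encode B y

infix 2 _by_

record Computable (A B : Type) (f : El A → El B) : Set where
  constructor _by_
  field
    program : Program
    correct : ∀ x → program ⊢ encode A x ⇓ encode B (f x)

private variable
  A B C Γ : Type

onHeadₑ : Expr → Expr
onHeadₑ X          = hd X
onHeadₑ nil        = nil
onHeadₑ (cons e f) = cons (onHeadₑ e) (onHeadₑ f)
onHeadₑ (hd e)     = hd (onHeadₑ e)
onHeadₑ (tl e)     = tl (onHeadₑ e)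

-- The language has a single variable, so a value that must survive a run is kept in its right
-- component while the program works on the left one.
onHead : Program → Program
onHead (X:= e)       = X:= cons (onHeadₑ e) (tl X)
onHead (p ⨾ q)       = onHead p ⨾ onHead q
onHead (while e ⟳ p) = while onHeadₑ e ⟳ onHead p

eval-onHeadₑ : ∀ e {x z} → eval (onHeadₑ e) (x ∙ z) ≡ eval e x
eval-onHeadₑ X          = refl
eval-onHeadₑ nil        = refl
eval-onHeadₑ (cons e f) = cong₂ _∙_ (eval-onHeadₑ e) (eval-onHeadₑ f)
eval-onHeadₑ (hd e)     = cong left (eval-onHeadₑ e)
eval-onHeadₑ (tl e)     = cong right (eval-onHeadₑ e)

onHead-⇓ : ∀ {p x y z} → p ⊢ x ⇓ y → onHead p ⊢ x ∙ z ⇓ y ∙ z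
onHead-⇓ {z = z} (assign {e} {x}) =
  subst (λ y → onHead (X:= e) ⊢ x ∙ z ⇓ y ∙ z) (eval-onHeadₑ e) assign
onHead-⇓ (seq d d′)               = seq (onHead-⇓ d) (onHead-⇓ d′)
onHead-⇓ (stop {e} eq)            = stop (trans (eval-onHeadₑ e) eq)
onHead-⇓ (loop {e} neq d d′)      =
  loop (neq ∘ trans (sym (eval-onHeadₑ e))) (onHead-⇓ d) (onHead-⇓ d′)

computable-cong : {f g : El A → El B} → (∀ x → f x ≡ g x) →
                  Computable A B f → Computable A B g
computable-cong {A} {B} f≗g (p by p⇓) =
  p by λ x → subst (λ y → p ⊢ encode A x ⇓ encode B y) (f≗g x) (p⇓ x)

infixr 9 _∘ᶜ_

_∘ᶜ_ : {g : El B → El C} {f : El A → El B} →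
       Computable B C g → Computable A B f → Computable A C (g ∘ f)
(q by q⇓) ∘ᶜ (p by p⇓) = (p ⨾ q) by λ x → seq (p⇓ x) (q⇓ _)

idᶜ : Computable A A id
idᶜ = X:= X by λ _ → assign

fst : Computable (A ⊗ B) A proj₁
fst = X:= hd X by λ _ → assign

snd : Computable (A ⊗ B) B proj₂
snd = X:= tl X by λ _ → assign

infixr 4 _,ᶜ_

_,ᶜ_ : {f : El Γ → El A} {g : El Γ → El B} →
       Computable Γ A f → Computable Γ B g →
       Computable Γ (A ⊗ B) (λ x → f x , g x)
(p by p⇓) ,ᶜ (q by q⇓) =
  -- The input is duplicated; each program runs on its own copy, and the second swap restores the
  -- order.
  (X:= cons X X ⨾ onHead p ⨾ X:= swap ⨾ onHead q ⨾ X:= swap) by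
  λ x → seq assign (seq (onHead-⇓ (p⇓ x)) (seq assign
          (seq (onHead-⇓ (q⇓ x)) assign)))
  where swap = cons (tl X) (hd X)

infixr 5 _∷ᶜ_

-- A nonempty list has the same code as the pair of its head and tail, so the pairing program serves
-- unchanged.
_∷ᶜ_ : {f : El Γ → El A} {g : El Γ → List (El A)} →
       Computable Γ A f → Computable Γ (list A) g →
       Computable Γ (list A) (λ x → f x ∷ g x)
_∷ᶜ_ {A = A} {f = f} {g = g} cf cg with cf ,ᶜ cg
... | p by p⇓ = p by p⇓

[]ᶜ : Computable Γ (list A) (const [])
[]ᶜ = X:= nil by λ _ → assign

falseᶜ : Computable Γ bool (const false)
falseᶜ = X:= nil by λ _ → assign

trueᶜ : Computable Γ bool (const true)
trueᶜ = X:= cons nil nil by λ _ → assign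

-- The expressions hd and tl send nil, the code of [], to itself.

head₀ : List (List (El A)) → List (El A)
head₀ []       = []
head₀ (xs ∷ _) = xs

head₀ᶜ : Computable (list (list A)) (list A) head₀
head₀ᶜ = X:= hd X by λ { [] → assign ; (_ ∷ _) → assign }

tailᶜ : Computable (list A) (list A) (drop 1)
tailᶜ = X:= tl X by λ { [] → assign ; (_ ∷ _) → assign }

-- Folds and the list functions obtained from them

foldlᶜ : {f : El (Γ ⊗ B ⊗ A) → El B} {i : El Γ → El B} {xs : El Γ → List (El A)} →
         Computable (Γ ⊗ B ⊗ A) B f → Computable Γ B i → Computable Γ (list A) xs →
         Computable Γ B (λ x → foldl (λ b a → f (x , b , a)) (i x) (xs x))
foldlᶜ {Γ} {B} {A} {f} {i} {xs} (p by p⇓) ci cxs =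
  (program ⨾ while hd X ⟳ body ⨾ X:= hd (tl X)) by
  λ x → seq (correct x) (seq (iterate x (xs x) (i x)) assign)
  where
  open Computable (cxs ,ᶜ ci ,ᶜ idᶜ {Γ})

  -- The loop state is `(as , b , x)`. `load` puts the argument `(x , b , a)` of `p` on the left and
  -- saves the remaining list and `x` on the right; `store` rebuilds the state.
  load  = cons (cons (tl (tl X)) (cons (hd (tl X)) (hd (hd X))))
               (cons (tl (hd X)) (tl (tl X)))
  store = cons (hd (tl X)) (cons (hd X) (tl (tl X)))
  body  = X:= load ⨾ onHead p ⨾ X:= store

  iterate : ∀ x as b → while hd X ⟳ body
    ⊢ encode (list A ⊗ B ⊗ Γ) (as , b , x)
    ⇓ encode (list A ⊗ B ⊗ Γ) ([] , foldl (λ b a → f (x , b , a)) b as , x)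
  iterate x []       b = stop refl
  iterate x (a ∷ as) b =
    loop headNonNil (seq assign (seq (onHead-⇓ (p⇓ (x , b , a))) assign))
         (iterate x as (f (x , b , a)))
    where
    headNonNil : encode (list A) (a ∷ as) ≢ nil
    headNonNil ()

reverseᶜ : {xs : El Γ → List (El A)} →
           Computable Γ (list A) xs → Computable Γ (list A) (reverse ∘ xs)
reverseᶜ = foldlᶜ ((snd ∘ᶜ snd) ∷ᶜ (fst ∘ᶜ snd)) []ᶜ

foldrᶜ : {f : El (Γ ⊗ A ⊗ B) → El B} {i : El Γ → El B} {xs : El Γ → List (El A)} →
         Computable (Γ ⊗ A ⊗ B) B f → Computable Γ B i → Computable Γ (list A) xs →
         Computable Γ B (λ x → foldr (λ a b → f (x , a , b)) (i x) (xs x))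
foldrᶜ {f = f} {i} {xs} cf ci cxs =
  computable-cong
    (λ x → reverse-foldl (λ b a → f (x , a , b)) (i x) (xs x))
    (foldlᶜ (cf ∘ᶜ (fst ,ᶜ (snd ∘ᶜ snd) ,ᶜ (fst ∘ᶜ snd))) ci (reverseᶜ cxs))

mapᶜ : {f : El (Γ ⊗ A) → El B} {xs : El Γ → List (El A)} →
       Computable (Γ ⊗ A) B f → Computable Γ (list A) xs →
       Computable Γ (list B) (λ x → map (λ a → f (x , a)) (xs x))
mapᶜ {xs = xs} cf cxs =
  computable-cong (λ x → sym (map-is-foldr (xs x)))
    (foldrᶜ ((cf ∘ᶜ (fst ,ᶜ (fst ∘ᶜ snd))) ∷ᶜ (snd ∘ᶜ snd)) []ᶜ cxs)

-- An instance is coded with two separate lists of images, but a new image depends on both images of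
-- its letter. Zipping is phrased as a `foldl` that consumes `ys` in its state, so that `foldlᶜ`
-- covers it.
pairUp : List (El A) → List (List (El B)) → List (El A × List (El B))
pairUp xs ys =
  reverse (proj₂ (foldl (λ (ys , zs) x → drop 1 ys , (x , head₀ ys) ∷ zs) (ys , []) xs))

pairUpᶜ : {xs : El Γ → List (El A)} {ys : El Γ → List (List (El B))} →
          Computable Γ (list A) xs → Computable Γ (list (list B)) ys →
          Computable Γ (list (A ⊗ list B)) (λ x → pairUp {A} {B} (xs x) (ys x))
pairUpᶜ cxs cys =
  reverseᶜ (snd ∘ᶜ foldlᶜ
    (tailᶜ ∘ᶜ rest ,ᶜ
     ((snd ∘ᶜ snd ,ᶜ head₀ᶜ ∘ᶜ rest) ∷ᶜ (snd ∘ᶜ fst ∘ᶜ snd)))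
    (cys ,ᶜ []ᶜ) cxs)
  where
  rest : Computable (Γ ⊗ (list A ⊗ B) ⊗ C) (list A) (λ x → proj₁ (proj₁ (proj₂ x)))
  rest = fst ∘ᶜ fst ∘ᶜ snd

pairUp-unzip : (ps : List (El A × List (El B))) →
               pairUp {A} {B} (map proj₁ ps) (map proj₂ ps) ≡ ps
pairUp-unzip {A} {B} ps =
  trans (cong (reverse ∘ proj₂) (go ps [])) (reverse-involutive ps)
  where
  go : ∀ ps zs →
       foldl (λ (ys , zs) x → drop 1 ys , (x , head₀ {B} ys) ∷ zs)
             (map proj₂ ps , zs) (map proj₁ ps)
       ≡ ([] , reverseAcc zs ps)
  go []       zs = refl
  go (p ∷ ps) zs = go ps (p ∷ zs)

-- Written as a fold with a constant step, so that `foldrᶜ` makes the case distinction computable.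
ifEmpty_then_else_ : {S T : Set} → List S → T → T → T
ifEmpty xs then y else z = foldr (λ _ _ → z) y xs

ifEmptyᶜ : {xs : El Γ → List (El A)} {y z : El Γ → El B} →
           Computable Γ (list A) xs → Computable Γ B y → Computable Γ B z →
           Computable Γ B (λ x → ifEmpty xs x then y x else z x)
ifEmptyᶜ cxs cy cz = foldrᶜ (cz ∘ᶜ fst) cy cxs

-- The images of the letters

-- Five symbols need three bits at constant length; constant length makes the splitting into symbols
-- unique.
pattern bit c r = c ∷ false ∷ false ∷ r
pattern sep r   = false ∷ true ∷ false ∷ r
pattern start r = false ∷ false ∷ true ∷ r
pattern finish r   = true ∷ false ∷ true ∷ r

sepBefore sepAfter : Word → Word → Word
sepBefore x r = foldr (λ c u → sep (bit c u)) r x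
sepAfter  x r = foldr (λ c u → bit c (sep u)) r x

startσ startτ finishσ finishτ : Word → Word
startσ s = start (sepBefore s [])
startτ s = start (sep (sepAfter s []))
finishσ t   = sepBefore t (sep (finish []))
finishτ t   = sepAfter t (finish [])

letterσ letterτ : Word → Word × Word → Word
letterσ s (x , y) =
  ifEmpty x then (ifEmpty y then startσ s else sepBefore x []) else sepBefore x []
letterτ s (x , y) =
  ifEmpty x then (ifEmpty y then startτ s else sepAfter y []) else sepAfter y []

-- The map on encoded instances and a program for it

word words : Type
word  = list bool
words = list word

gpcp : Type
gpcp = words ⊗ words ⊗ word ⊗ word ⊗ word ⊗ word

pcp : Type
pcp = words ⊗ words

reduce : El gpcp → El pcp
reduce (σs , τs , s , t , s′ , t′) =
  (startσ s  ∷ finishσ t  ∷ map (letterσ s)  ps) ,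
  (startτ s′ ∷ finishτ t′ ∷ map (letterτ s′) ps)
  where ps = pairUp {word} {bool} σs τs

private variable
  w w′ : El Γ → Word

sepᶜ : Computable Γ word w → Computable Γ word (λ x → sep (w x))
sepᶜ cw = falseᶜ ∷ᶜ trueᶜ ∷ᶜ falseᶜ ∷ᶜ cw

bitᶜ : {b : El Γ → Bool} → Computable Γ bool b → Computable Γ word w →
       Computable Γ word (λ x → bit (b x) (w x))
bitᶜ cb cw = cb ∷ᶜ falseᶜ ∷ᶜ falseᶜ ∷ᶜ cw

startᶜ : Computable Γ word w → Computable Γ word (λ x → start (w x))
startᶜ cw = falseᶜ ∷ᶜ falseᶜ ∷ᶜ trueᶜ ∷ᶜ cw

finishᶜ : Computable Γ word w → Computable Γ word (λ x → finish (w x))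
finishᶜ cw = trueᶜ ∷ᶜ falseᶜ ∷ᶜ trueᶜ ∷ᶜ cw

sepBeforeᶜ : Computable Γ word w → Computable Γ word w′ →
             Computable Γ word (λ x → sepBefore (w x) (w′ x))
sepBeforeᶜ cw cw′ = foldrᶜ (sepᶜ (bitᶜ (fst ∘ᶜ snd) (snd ∘ᶜ snd))) cw′ cw

sepAfterᶜ : Computable Γ word w → Computable Γ word w′ →
            Computable Γ word (λ x → sepAfter (w x) (w′ x))
sepAfterᶜ cw cw′ = foldrᶜ (bitᶜ (fst ∘ᶜ snd) (sepᶜ (snd ∘ᶜ snd))) cw′ cw

startσᶜ : Computable Γ word w → Computable Γ word (startσ ∘ w)
startσᶜ cw = startᶜ (sepBeforeᶜ cw []ᶜ)

startτᶜ : Computable Γ word w → Computable Γ word (startτ ∘ w)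
startτᶜ cw = startᶜ (sepᶜ (sepAfterᶜ cw []ᶜ))

letterσᶜ : Computable Γ word w →
           Computable (Γ ⊗ word ⊗ word) word (λ x → letterσ (w (proj₁ x)) (proj₂ x))
letterσᶜ cw =
  ifEmptyᶜ (fst ∘ᶜ snd) (ifEmptyᶜ (snd ∘ᶜ snd) (startσᶜ (cw ∘ᶜ fst)) image) image
  where image = sepBeforeᶜ (fst ∘ᶜ snd) []ᶜ

letterτᶜ : Computable Γ word w →
           Computable (Γ ⊗ word ⊗ word) word (λ x → letterτ (w (proj₁ x)) (proj₂ x))
letterτᶜ cw =
  ifEmptyᶜ (fst ∘ᶜ snd) (ifEmptyᶜ (snd ∘ᶜ snd) (startτᶜ (cw ∘ᶜ fst)) image) image
  where image = sepAfterᶜ (snd ∘ᶜ snd) []ᶜ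

reduceᶜ : Computable gpcp pcp reduce
reduceᶜ =
  startσᶜ s  ∷ᶜ sepBeforeᶜ t (sepᶜ (finishᶜ []ᶜ)) ∷ᶜ mapᶜ (letterσᶜ s) ps ,ᶜ
  startτᶜ s′ ∷ᶜ sepAfterᶜ t′ (finishᶜ []ᶜ)        ∷ᶜ mapᶜ (letterτᶜ s′) ps
  where
  ps : Computable gpcp (list (word ⊗ word)) _
  ps = pairUpᶜ fst (fst ∘ᶜ snd)
  s  = fst ∘ᶜ snd ∘ᶜ snd
  t  = fst ∘ᶜ snd ∘ᶜ snd ∘ᶜ snd
  s′ = fst ∘ᶜ snd ∘ᶜ snd ∘ᶜ snd ∘ᶜ snd
  t′ = snd ∘ᶜ snd ∘ᶜ snd ∘ᶜ snd ∘ᶜ snd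

-- Correctness of the reduction

sepBefore-[]-++ : ∀ x r → sepBefore x [] ++ r ≡ sepBefore x r
sepBefore-[]-++ []      r = refl
sepBefore-[]-++ (c ∷ x) r = cong (λ u → sep (bit c u)) (sepBefore-[]-++ x r)

sepAfter-[]-++ : ∀ x r → sepAfter x [] ++ r ≡ sepAfter x r
sepAfter-[]-++ []      r = refl
sepAfter-[]-++ (c ∷ x) r = cong (λ u → bit c (sep u)) (sepAfter-[]-++ x r)

sepBefore-++ : ∀ x y r → sepBefore (x ++ y) r ≡ sepBefore x (sepBefore y r)
sepBefore-++ x y r = foldr-++ _ r x y

sepAfter-++ : ∀ x y r → sepAfter (x ++ y) r ≡ sepAfter x (sepAfter y r)
sepAfter-++ x y r = foldr-++ _ r x y

finishσ-++ : ∀ x r → finishσ x ++ r ≡ sepBefore x (sep (finish r))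
finishσ-++ []      r = refl
finishσ-++ (c ∷ x) r = cong (λ u → sep (bit c u)) (finishσ-++ x r)

finishτ-++ : ∀ x r → finishτ x ++ r ≡ sepAfter x (finish r)
finishτ-++ []      r = refl
finishτ-++ (c ∷ x) r = cong (λ u → bit c (sep u)) (finishτ-++ x r)

-- Regroups d x₁ ... d xₘ d as d followed by x₁ d ... xₘ d: one more separator turns the σ-spelling
-- into the τ-spelling.
sepBefore-sep : ∀ x r → sepBefore x (sep r) ≡ sep (sepAfter x r)
sepBefore-sep []      r = refl
sepBefore-sep (c ∷ x) r = cong (λ u → sep (bit c u)) (sepBefore-sep x r)

∷-injectiveʳ⁶ : ∀ {S : Set} {a b c d e f a′ b′ c′ d′ e′ f′ : S} {xs ys} →
  a ∷ b ∷ c ∷ d ∷ e ∷ f ∷ xs ≡ a′ ∷ b′ ∷ c′ ∷ d′ ∷ e′ ∷ f′ ∷ ys → xs ≡ ys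
∷-injectiveʳ⁶ refl = refl

-- The symbol ◁ cannot be mistaken for a bit, so it marks the end of both words. The tails are
-- arbitrary because a solution may continue after its first finish letter.
sepAfter-finish-injective : ∀ x y {r r′} →
                         sepAfter x (finish r) ≡ sepAfter y (finish r′) → x ≡ y
sepAfter-finish-injective []      []      _  = refl
sepAfter-finish-injective []      (_ ∷ _) ()
sepAfter-finish-injective (_ ∷ _) []      ()
sepAfter-finish-injective (c ∷ x) (d ∷ y) eq =
  cong₂ _∷_ (∷-injectiveˡ eq) (sepAfter-finish-injective x y (∷-injectiveʳ⁶ eq))

-- The two ways in which `scan` could break off before a finish letter: the solution ends, or a
-- start letter or a copy of it comes up.
data Stop : Word → Set where
  atEmpty : Stop []
  atStart : ∀ r → Stop (start r)

-- A separator and a bit are two blocks, so before r and r′ there is an even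
-- number of blocks on the left and an odd number on the right.

sepBefore≢sepAfter : ∀ x y {r r′} → Stop r → Stop r′ →
                     sepBefore x r ≢ sep (sepAfter y r′)
sepBefore≢sepAfter []      y       atEmpty     _           ()
sepBefore≢sepAfter []      y       (atStart _) _           ()
sepBefore≢sepAfter (_ ∷ x) []      _           atEmpty     ()
sepBefore≢sepAfter (_ ∷ x) []      _           (atStart _) ()
sepBefore≢sepAfter (c ∷ x) (d ∷ y) p           q           eq =
  sepBefore≢sepAfter x y p q (∷-injectiveʳ⁶ eq)

⟦⟧-[] : ∀ {S T} (φ : Morphism S T) → ⟦ φ ⟧ [] ≡ []
⟦⟧-[] φ = ++-identityˡ-unique (⟦ φ ⟧ []) (Morphism.homo φ [] [])

fromLetters : ∀ {S T : Set} → (S → List T) → Morphism S T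
fromLetters f = record { ⟦_⟧ = concatMap f ; homo = concatMap-++ f }

regroup : ∀ {S T} (φ : Morphism S T) x a w u →
         (x ++ ⟦ φ ⟧ [ a ]) ++ ⟦ φ ⟧ w ++ u ≡ x ++ ⟦ φ ⟧ (a ∷ w) ++ u
regroup φ x a w u = trans (++-assoc x _ _) (cong (x ++_)
  (trans (sym (++-assoc (⟦ φ ⟧ [ a ]) _ u))
         (cong (_++ u) (sym (Morphism.homo φ [ a ] w)))))

module _ {k} (i : GPCPInstance k) where
  open GPCPInstance i

  images : Fin k → Word × Word
  images a = ⟦ σ ⟧ [ a ] , ⟦ τ ⟧ [ a ]

  imageσ imageτ : Fin (2 + k) → Word
  imageσ zero          = startσ s
  imageσ (suc zero)    = finishσ t
  imageσ (suc (suc a)) = letterσ s (images a)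
  imageτ zero          = startτ s′
  imageτ (suc zero)    = finishτ t′
  imageτ (suc (suc a)) = letterτ s′ (images a)

  toPCP : PCPInstance (2 + k)
  toPCP = record { σ = fromLetters imageσ ; τ = fromLetters imageτ }

  -- Classifying by the pair of images puts a letter erased by both morphisms under `isStart`. The
  -- equations leave `x` and `y` free to be matched on.
  data Kind : Word → Word → Set where
    isStart  : Kind (startσ s) (startτ s′)
    isFinish    : Kind (finishσ t) (finishτ t′)
    isLetter : ∀ a {x y} → ⟦ σ ⟧ [ a ] ≡ x → ⟦ τ ⟧ [ a ] ≡ y → x ++ y ≢ [] →
               Kind (sepBefore x []) (sepAfter y [])

  kind : ∀ c → Kind (imageσ c) (imageτ c)
  kind zero          = isStart
  kind (suc zero)    = isFinish
  kind (suc (suc a)) with ⟦ σ ⟧ [ a ] in eqσ | ⟦ τ ⟧ [ a ] in eqτ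
  ... | []    | []    = isStart
  ... | []    | _ ∷ _ = isLetter a eqσ eqτ λ ()
  ... | _ ∷ _ | _     = isLetter a eqσ eqτ λ ()

  -- From a solution of the PCP instance to one of the GPCP instance

  σ′ τ′ : List (Fin (2 + k)) → Word
  σ′ = concatMap imageσ
  τ′ = concatMap imageτ

  -- An empty image defers to the rest of the word; every other σ-image opens with `sep` or `start`.
  -- This bars a solution from opening with a letter erased by σ alone.
  σ′≢bit : ∀ w {c r} → σ′ w ≢ bit c r
  σ′≢bit (c ∷ w) eq with imageσ c | imageτ c | kind c
  ... | _ | _ | isStart with () ← eq
  ... | _ | _ | isFinish with t | eq
  ...   | []    | ()
  ...   | _ ∷ _ | ()
  σ′≢bit (c ∷ w) eq | _ | _ | isLetter _ {[]}    _ _ _ = σ′≢bit w eq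
  σ′≢bit (c ∷ w) () | _ | _ | isLetter _ {_ ∷ _} _ _ _

  τ′≢sep : ∀ w {r} → τ′ w ≢ sep r
  τ′≢sep (c ∷ w) eq with imageσ c | imageτ c | kind c
  ... | _ | _ | isStart with () ← eq
  ... | _ | _ | isFinish with t′ | eq
  ...   | []    | ()
  ...   | _ ∷ _ | ()
  τ′≢sep (c ∷ w) eq | _ | _ | isLetter _ {y = []}    _ _ _ = τ′≢sep w eq
  τ′≢sep (c ∷ w) () | _ | _ | isLetter _ {y = _ ∷ _} _ _ _

  open ≡-Reasoning

  -- Induction on the unread letters `w`: `x` and `y` are the bits spelt so far on the two sides,
  -- and the leading `sep` on the right is the separator in excess.
  scan : ∀ w x y → sepBefore x (σ′ w) ≡ sep (sepAfter y (τ′ w)) →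
         ∃[ v ] x ++ ⟦ σ ⟧ v ++ t ≡ y ++ ⟦ τ ⟧ v ++ t′
  scan []      x y eq = contradiction eq (sepBefore≢sepAfter x y atEmpty atEmpty)
  scan (c ∷ w) x y eq with imageσ c | imageτ c | kind c
  ... | _ | _ | isStart =
    contradiction eq (sepBefore≢sepAfter x y (atStart _) (atStart _))
  ... | _ | _ | isFinish =
    -- The first finish letter closes the GPCP solution; the letters `w` after it are discarded. The
    -- three injections below strip the bits of the leading `sep`.
    [] , subst₂ (λ u v → x ++ u ++ t ≡ y ++ v ++ t′) (sym (⟦⟧-[] σ)) (sym (⟦⟧-[] τ))
      (sepAfter-finish-injective (x ++ t) (y ++ t′)
        (∷-injectiveʳ (∷-injectiveʳ (∷-injectiveʳ (begin
          sep (sepAfter (x ++ t) (finish (σ′ w)))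
            ≡⟨ sepBefore-sep (x ++ t) _ ⟨
          sepBefore (x ++ t) (sep (finish (σ′ w)))
            ≡⟨ sepBefore-++ x t _ ⟩
          sepBefore x (sepBefore t (sep (finish (σ′ w))))
            ≡⟨ cong (sepBefore x) (finishσ-++ t _) ⟨
          sepBefore x (finishσ t ++ σ′ w)
            ≡⟨ eq ⟩
          sep (sepAfter y (finishτ t′ ++ τ′ w))
            ≡⟨ cong (sep ∘ sepAfter y) (finishτ-++ t′ _) ⟩
          sep (sepAfter y (sepAfter t′ (finish (τ′ w))))
            ≡⟨ cong sep (sepAfter-++ y t′ _) ⟨
          sep (sepAfter (y ++ t′) (finish (τ′ w))) ∎)))))
  ... | _ | _ | isLetter a {u} {v} refl refl _ =
    let z , eq′ = scan w (x ++ u) (y ++ v) (begin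
          sepBefore (x ++ u) (σ′ w)
            ≡⟨ sepBefore-++ x u _ ⟩
          sepBefore x (sepBefore u (σ′ w))
            ≡⟨ cong (sepBefore x) (sepBefore-[]-++ u _) ⟨
          sepBefore x (sepBefore u [] ++ σ′ w)
            ≡⟨ eq ⟩
          sep (sepAfter y (sepAfter v [] ++ τ′ w))
            ≡⟨ cong (sep ∘ sepAfter y) (sepAfter-[]-++ v _) ⟩
          sep (sepAfter y (sepAfter v (τ′ w)))
            ≡⟨ cong sep (sepAfter-++ y v _) ⟨
          sep (sepAfter (y ++ v) (τ′ w)) ∎)
    in a ∷ z , trans (sym (regroup σ x a z t)) (trans eq′ (regroup τ y a z t′))

  sound : ∀ w → w ≢ [] → σ′ w ≡ τ′ w →
          ∃[ v ] s ++ ⟦ σ ⟧ v ++ t ≡ s′ ++ ⟦ τ ⟧ v ++ t′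
  sound []      w≢[] _  = contradiction refl w≢[]
  sound (c ∷ w) _    eq
    -- The two exclusions are abstracted together with the images, so that in each case they speak
    -- of the concrete image.
    with imageσ c | imageτ c | kind c
       | (λ {b r} → σ′≢bit (c ∷ w) {b} {r}) | (λ {r} → τ′≢sep (c ∷ w) {r})
  ... | _ | _ | isStart | _ | _ = scan w s s′ (begin
    sepBefore s (σ′ w)
      ≡⟨ sepBefore-[]-++ s _ ⟨
    sepBefore s [] ++ σ′ w
      ≡⟨ ∷-injectiveʳ (∷-injectiveʳ (∷-injectiveʳ eq)) ⟩
    sep (sepAfter s′ [] ++ τ′ w)
      ≡⟨ cong sep (sepAfter-[]-++ s′ _) ⟩
    sep (sepAfter s′ (τ′ w)) ∎)
  -- Even for empty `t` the σ-side opens with a separator here, which the τ-side cannot do.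
  ... | _ | _ | isFinish | _ | ≢sep =
    contradiction (trans (sym eq) (trans (finishσ-++ t _) (sepBefore-sep t _))) ≢sep
  ... | _ | _ | isLetter _ {_ ∷ _}      _ _ _  | _    | ≢sep = contradiction (sym eq) ≢sep
  ... | _ | _ | isLetter _ {[]} {_ ∷ _} _ _ _  | ≢bit | _    = contradiction eq ≢bit
  ... | _ | _ | isLetter _ {[]} {[]}    _ _ ne | _    | _    = contradiction refl ne

  -- From a solution of the GPCP instance to one of the PCP instance

  addLetter : ∀ a w → ∃[ w′ ] σ′ w′ ≡ sepBefore (⟦ σ ⟧ [ a ]) (σ′ w)
                            × τ′ w′ ≡ sepAfter (⟦ τ ⟧ [ a ]) (τ′ w)
  addLetter a w with ⟦ σ ⟧ [ a ] in eqσ | ⟦ τ ⟧ [ a ] in eqτ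
  -- A letter erased by both morphisms is left out, its new letter being a copy of the start letter.
  ... | []    | []    = w , refl , refl
  ... | []    | y@(_ ∷ _) = suc (suc a) ∷ w , eq₁ , eq₂
    where
    eq₁ : letterσ s (images a) ++ σ′ w ≡ σ′ w
    eq₁ rewrite eqσ | eqτ = refl
    eq₂ : letterτ s′ (images a) ++ τ′ w ≡ sepAfter y (τ′ w)
    eq₂ rewrite eqσ | eqτ = sepAfter-[]-++ y _
  ... | x@(_ ∷ _) | y     = suc (suc a) ∷ w , eq₁ , eq₂
    where
    eq₁ : letterσ s (images a) ++ σ′ w ≡ sepBefore x (σ′ w)
    eq₁ rewrite eqσ = sepBefore-[]-++ x _
    eq₂ : letterτ s′ (images a) ++ τ′ w ≡ sepAfter y (τ′ w)
    eq₂ rewrite eqσ | eqτ = sepAfter-[]-++ y _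

  addLetters : ∀ v w → ∃[ w′ ] σ′ w′ ≡ sepBefore (⟦ σ ⟧ v) (σ′ w)
                             × τ′ w′ ≡ sepAfter (⟦ τ ⟧ v) (τ′ w)
  addLetters []      w rewrite ⟦⟧-[] σ | ⟦⟧-[] τ = w , refl , refl
  addLetters (a ∷ v) w =
    let w₁ , eqσ₁ , eqτ₁ = addLetters v w
        w₂ , eqσ₂ , eqτ₂ = addLetter a w₁
    in  w₂ ,
        (begin
          σ′ w₂
            ≡⟨ eqσ₂ ⟩
          sepBefore (⟦ σ ⟧ [ a ]) (σ′ w₁)
            ≡⟨ cong (sepBefore (⟦ σ ⟧ [ a ])) eqσ₁ ⟩
          sepBefore (⟦ σ ⟧ [ a ]) (sepBefore (⟦ σ ⟧ v) (σ′ w))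
            ≡⟨ sepBefore-++ (⟦ σ ⟧ [ a ]) _ _ ⟨
          sepBefore (⟦ σ ⟧ [ a ] ++ ⟦ σ ⟧ v) (σ′ w)
            ≡⟨ cong (λ u → sepBefore u (σ′ w)) (Morphism.homo σ [ a ] v) ⟨
          sepBefore (⟦ σ ⟧ (a ∷ v)) (σ′ w) ∎) ,
        (begin
          τ′ w₂
            ≡⟨ eqτ₂ ⟩
          sepAfter (⟦ τ ⟧ [ a ]) (τ′ w₁)
            ≡⟨ cong (sepAfter (⟦ τ ⟧ [ a ])) eqτ₁ ⟩
          sepAfter (⟦ τ ⟧ [ a ]) (sepAfter (⟦ τ ⟧ v) (τ′ w))
            ≡⟨ sepAfter-++ (⟦ τ ⟧ [ a ]) _ _ ⟨
          sepAfter (⟦ τ ⟧ [ a ] ++ ⟦ τ ⟧ v) (τ′ w)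
            ≡⟨ cong (λ u → sepAfter u (τ′ w)) (Morphism.homo τ [ a ] v) ⟨
          sepAfter (⟦ τ ⟧ (a ∷ v)) (τ′ w) ∎)

  complete : ∀ v → s ++ ⟦ σ ⟧ v ++ t ≡ s′ ++ ⟦ τ ⟧ v ++ t′ →
             ∃[ w ] w ≢ [] × σ′ w ≡ τ′ w
  complete v eq =
    -- The solution consists of the start letter `zero`, the letters of `v` not erased by both
    -- morphisms, and the finish letter `suc zero`.
    let w , eqσ , eqτ = addLetters v [ suc zero ]
    in  zero ∷ w , (λ ()) , cong start (begin
      sepBefore s [] ++ σ′ w
        ≡⟨ sepBefore-[]-++ s _ ⟩
      sepBefore s (σ′ w)
        ≡⟨ cong (sepBefore s) eqσ ⟩
      sepBefore s (sepBefore (⟦ σ ⟧ v) (finishσ t ++ []))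
        ≡⟨ cong (sepBefore s ∘ sepBefore (⟦ σ ⟧ v)) (finishσ-++ t []) ⟩
      sepBefore s (sepBefore (⟦ σ ⟧ v) (sepBefore t (sep (finish []))))
        ≡⟨ cong (sepBefore s) (sepBefore-++ (⟦ σ ⟧ v) t _) ⟨
      sepBefore s (sepBefore (⟦ σ ⟧ v ++ t) (sep (finish [])))
        ≡⟨ sepBefore-++ s _ _ ⟨
      sepBefore (s ++ ⟦ σ ⟧ v ++ t) (sep (finish []))
        ≡⟨ cong (λ u → sepBefore u (sep (finish []))) eq ⟩
      sepBefore (s′ ++ ⟦ τ ⟧ v ++ t′) (sep (finish []))
        ≡⟨ sepBefore-sep (s′ ++ ⟦ τ ⟧ v ++ t′) _ ⟩
      sep (sepAfter (s′ ++ ⟦ τ ⟧ v ++ t′) (finish []))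
        ≡⟨ cong sep (begin
        sepAfter (s′ ++ ⟦ τ ⟧ v ++ t′) (finish [])
          ≡⟨ sepAfter-++ s′ _ _ ⟩
        sepAfter s′ (sepAfter (⟦ τ ⟧ v ++ t′) (finish []))
          ≡⟨ cong (sepAfter s′) (sepAfter-++ (⟦ τ ⟧ v) t′ _) ⟩
        sepAfter s′ (sepAfter (⟦ τ ⟧ v) (sepAfter t′ (finish [])))
          ≡⟨ cong (sepAfter s′ ∘ sepAfter (⟦ τ ⟧ v)) (finishτ-++ t′ []) ⟨
        sepAfter s′ (sepAfter (⟦ τ ⟧ v) (finishτ t′ ++ []))
          ≡⟨ cong (sepAfter s′) eqτ ⟨
        sepAfter s′ (τ′ w)
          ≡⟨ sepAfter-[]-++ s′ _ ⟨
        sepAfter s′ [] ++ τ′ w ∎) ⟩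
      sep (sepAfter s′ [] ++ τ′ w) ∎)

  toPCP-correct : Problem.Yes (PCP (2 + k)) toPCP ⇔ Problem.Yes (GPCP k) i
  toPCP-correct = mk⇔ (λ (w , w≢[] , eq) → sound w w≢[] eq) (uncurry complete)

  -- Preservation of erasement-freeness

  toPCP-erasementFree : ErasementFreeGPCP i → ErasementFreePCP toPCP
  toPCP-erasementFree (σ-ne , τ-ne) = nonErasing σ-image , nonErasing τ-image
    where
    nonErasing : {f : Fin (2 + k) → Word} → (∀ c → f c ≢ []) → NonErasing (fromLetters f)
    nonErasing {f} ne c = ne c ∘ trans (sym (++-identityʳ (f c)))

    σ-image : ∀ c → imageσ c ≢ []
    σ-image zero          ()
    σ-image (suc zero)    eq with t | eq
    ... | []    | ()
    ... | _ ∷ _ | ()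
    σ-image (suc (suc a)) eq with ⟦ σ ⟧ [ a ] | σ-ne a | eq
    ... | []    | ne | _ = ne refl
    ... | _ ∷ _ | _  | ()

    τ-image : ∀ c → imageτ c ≢ []
    τ-image zero          ()
    τ-image (suc zero)    eq with t′ | eq
    ... | []    | ()
    ... | _ ∷ _ | ()
    -- `letterτ` tests the σ-image first, so that image has to be split as well.
    τ-image (suc (suc a)) eq with ⟦ σ ⟧ [ a ] | σ-ne a | ⟦ τ ⟧ [ a ] | τ-ne a | eq
    ... | []    | ne | _     | _  | _ = ne refl
    ... | _ ∷ _ | _  | []    | ne | _ = ne refl
    ... | _ ∷ _ | _  | _ ∷ _ | _  | ()

  -- Agreement of the program with the coding of instances

  tabulated : El gpcp
  tabulated = tabulate (proj₁ ∘ images) , tabulate (proj₂ ∘ images) , s , t , s′ , t′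

  reduce-tabulated : encode pcp (reduce tabulated) ≡ Problem.code (PCP (2 + k)) toPCP
  reduce-tabulated =
    cong (encode pcp) (cong₂ _,_ (table imageσ refl) (table imageτ refl))
    where
    ps : List (Word × Word)
    ps = pairUp {word} {bool} (tabulate (proj₁ ∘ images)) (tabulate (proj₂ ∘ images))

    ps≡images : ps ≡ tabulate images
    ps≡images = trans
      (sym (cong₂ (pairUp {word} {bool}) (map-tabulate images proj₁)
                                         (map-tabulate images proj₂)))
      (pairUp-unzip (tabulate images))

    table : ∀ (f : Fin (2 + k) → Word) {g : Word × Word → Word} →
            (λ a → f (suc (suc a))) ≡ g ∘ images →
            f zero ∷ f (suc zero) ∷ map g ps ≡ tabulate (λ c → concatMap f [ c ])
    table f {g} eq = begin
      f zero ∷ f (suc zero) ∷ map g ps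
        ≡⟨ cong (λ ps → f zero ∷ f (suc zero) ∷ map g ps) ps≡images ⟩
      f zero ∷ f (suc zero) ∷ map g (tabulate images)
        ≡⟨ cong (λ xs → f zero ∷ f (suc zero) ∷ xs) (map-tabulate images g) ⟩
      f zero ∷ f (suc zero) ∷ tabulate (g ∘ images)
        ≡⟨ cong (λ h → f zero ∷ f (suc zero) ∷ tabulate h) eq ⟨
      tabulate f
        -- A morphism is coded by its values on one-letter words, where `concatMap` leaves a
        -- trailing `++ []`.
        ≡⟨ tabulate-cong (λ c → ++-identityʳ (f c)) ⟨
      tabulate (λ c → concatMap f [ c ]) ∎

-- Transfer of decidability along a computable reduction

DecidableOn-reduction :
  ∀ {P Q : Problem} {C : Pred (Problem.Instance P) 0ℓ} {D : Pred (Problem.Instance Q) 0ℓ}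
  (f : Problem.Instance P → Problem.Instance Q) (r : Program) →
  (∀ i → r ⊢ Problem.code P i ⇓ Problem.code Q (f i)) →
  (∀ i → Problem.Yes Q (f i) ⇔ Problem.Yes P i) →
  (∀ i → C i → D (f i)) →
  DecidableOn Q D → DecidableOn P C
DecidableOn-reduction f r r⇓ f-correct C⇒D (p , p⇓) =
  (r ⨾ p) , λ i Ci → let b , run , reflects = p⇓ (f i) (C⇒D i Ci)
                     in  b , seq (r⇓ i) run , transport (f-correct i) reflects
  where
  transport : ∀ {S T : Set} {b} → S ⇔ T → Reflects S b → Reflects T b
  transport S⇔T (ofʸ  s) = ofʸ (Equivalence.to S⇔T s)
  transport S⇔T (ofⁿ ¬s) = ofⁿ (¬s ∘ Equivalence.from S⇔T)

GPCP-reduction : ∀ k {C : Pred (GPCPInstance k) 0ℓ} {D : Pred (PCPInstance (2 + k)) 0ℓ} →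
                 (∀ i → C i → D (toPCP i)) →
                 DecidableOn (PCP (2 + k)) D → DecidableOn (GPCP k) C
GPCP-reduction k =
  DecidableOn-reduction {GPCP k} {PCP (2 + k)} toPCP program
    -- The code of `tabulated i` is that of `i` by computation, so only the output code is
    -- rewritten.
    (λ i → subst (program ⊢ Problem.code (GPCP k) i ⇓_) (reduce-tabulated i)
             (correct (tabulated i)))
    toPCP-correct
  where open Computable reduceᶜ

theorem2 : (k : ℕ) → 1 ≤ k →
    (Decidable (PCP (k + 2)) → Decidable (GPCP k))
    × (DecidableOn (PCP (k + 2)) ErasementFreePCP →
    DecidableOn (GPCP k) ErasementFreeGPCP)
-- In `Fin (2 + k)` the two new letters are the explicit patterns `zero` and `suc zero`, hence the
-- swap.
theorem2 k _ rewrite +-comm k 2 =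
  GPCP-reduction k _ , GPCP-reduction k toPCP-erasementFree
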